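{- For every list (of any length $l$, in any initial order) and every request sequence $\sigma$ of length $n$, there is a deterministic online algorithm with advice that serves $\sigma$ at cost exactly $\mathrm{OPT}(\sigma)$ while reading at most $\mathrm{OPT}(\sigma)-n$ bits of advice, where costs are measured in the full cost model.
   Context: Static list update problem: a list contains $l$ distinct items in some initial order; a request sequence $\sigma=\langle\sigma_1,\dots,\sigma_n\rangle$ of items of the list must be served in order (online: when serving $\sigma_t$ the algorithm does not know $\sigma_{t+1},\dots$). Serving a request to the item currently at position $i$ (positions $1,\dots,l$ from the front) costs $i$ in the full cost model and $i-1$ in the partial cost model. Immediately after an access, the accessed item may be moved to any position closer to the front at no cost (free exchange); at any time, two adjacent items may be swapped at cost $1$ (paid exchange). For an algorithm $A$, $A(\sigma)$ denotes its total cost on $\sigma$, and $\mathrm{OPT}(\sigma)$ denotes the minimum total cost of any offline algorithm (knowing $\sigma$ in advance) serving $\sigma$ from the same initial list. Advice model: before serving, a benevolent oracle that knows the whole sequence $\sigma$ writes an infinite binary string (the advice tape); the online algorithm may read bits from the tape at any time. The number of advice bits read on $\sigma$ is the length of the shortest prefix of the tape containing all bits accessed. -}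

module Defs where

open import Data.Bool using (Bool)
open import Data.List using (List; []; _∷_; _++_; [_]; length)
open import Data.List.Membership.Propositional using (_∈_)
open import Data.List.Relation.Binary.Permutation.Propositional
  using (_↭_; ↭-refl; ↭-trans; swap)
open import Data.List.Relation.Binary.Permutation.Propositional.Properties
  using (∈-resp-↭; ++⁺ˡ; shift)
open import Data.List.Relation.Unary.All as All using (All; []; _∷_)
open import Data.Nat using (ℕ; suc; _+_; _≤_; _⊔_)
open import Data.Product using (_×_; _,_; ∃-syntax)

private
  variable
    A B : Set
    L L′ : List A
    σ : List A
    c : ℕ

-- Schedule L σ L′ c: a sequence of operations that serves σ starting from
-- the list L, ends with the list L′ and has total cost c in the full cost
-- model.  The step `access` includes the free exchange that may immediately
-- follow it: x jumps over the (possibly empty) segment ys.  Paid exchanges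
-- may occur anywhere, also after the last request.
data Schedule {A : Set} : List A → List A → List A → ℕ → Set where
  done     : Schedule L [] L 0
  exchange : ∀ xs a b ys →
             Schedule (xs ++ b ∷ a ∷ ys) σ L′ c →
             Schedule (xs ++ a ∷ b ∷ ys) σ L′ (1 + c)
  access   : ∀ xs ys x zs →
             Schedule (xs ++ x ∷ ys ++ zs) σ L′ c →
             Schedule (xs ++ ys ++ x ∷ zs) (x ∷ σ) L′
                      (suc (length (xs ++ ys)) + c)

IsOPT : List A → List A → ℕ → Set
IsOPT L σ opt =
  (∃[ L′ ] Schedule L σ L′ opt) × (∀ {L′ c} → Schedule L σ L′ c → opt ≤ c)

schedule⇒↭ : Schedule L σ L′ c → L ↭ L′
schedule⇒↭ done = ↭-refl
schedule⇒↭ (exchange xs a b ys s) =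
  ↭-trans (++⁺ˡ xs (swap a b ↭-refl)) (schedule⇒↭ s)
schedule⇒↭ (access xs ys x zs s) =
  ↭-trans (++⁺ˡ xs (shift x ys zs)) (schedule⇒↭ s)

Tape : Set
Tape = ℕ → Bool

-- A deterministic computation that sees the advice tape only through queries
-- of the form "what is the bit at address i?" (addresses start at 0).
data Advised (B : Set) : Set where
  return : B → Advised B
  read   : (i : ℕ) → (Bool → Advised B) → Advised B

eval : Tape → Advised B → B
eval tape (return b) = b
eval tape (read i k) = eval tape (k (tape i))

-- Length of the shortest prefix of the tape containing all bits accessed.
prefixRead : Tape → Advised B → ℕ
prefixRead tape (return b) = 0
prefixRead tape (read i k) = suc i ⊔ prefixRead tape (k (tape i))

record Response {A : Set} (State : Set) (L : List A) (x : A) : Set where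
  constructor response
  field
    newState : State
    {newList} : List A
    {stepCost} : ℕ
    schedule : Schedule L [ x ] newList stepCost

-- On each request the algorithm knows its own state, the current list and the
-- requested item.  Everything it remembers of the past (such as which part of
-- the tape it has read) is in the state.
record OnlineAlgorithm (A : Set) : Set₁ where
  field
    State   : Set
    start   : (L₀ : List A) → State
    respond : State → (L : List A) (x : A) → x ∈ L → Advised (Response State L x)

record Outcome : Set where
  constructor outcome
  field
    cost     : ℕ
    bitsRead : ℕ

module _ (alg : OnlineAlgorithm A) (tape : Tape) where
  open OnlineAlgorithm alg
  open Response
  open Outcome

  runFrom : State → (L σ : List A) → All (_∈ L) σ → Outcome
  runFrom s L []      []            = outcome 0 0
  runFrom s L (x ∷ σ) (x∈L ∷ σ∈L) =
    outcome (stepCost r + cost rest) (prefixRead tape computation ⊔ bitsRead rest)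
    where
    computation = respond s L x x∈L
    r = eval tape computation
    rest = runFrom (newState r) (newList r) σ
             (All.map (∈-resp-↭ (schedule⇒↭ (schedule r))) σ∈L)

  run : (L₀ σ : List A) → All (_∈ L₀) σ → Outcome
  run L₀ = runFrom (start L₀) L₀

{-# OPTIONS --safe #-}
-- By the subset transfer theorem of Reingold and Westbrook, some optimal
-- schedule changes the list only as follows: on a request to x, a subset of
-- the items in front of x is moved to just behind x, preserving order.  If x
-- is at position i, such a step costs at least i, while the subset is described
-- by one bit for each of the i − 1 items in front of x.
--
-- The subset transfer theorem follows by induction from one exchange argument:
-- swapping two adjacent items of the initial list changes the optimal cost of
-- serving a request sequence by subset transfers by at most 1.
module Submission where

open import Data.Bool using (Bool; true; false)
open import Data.List using (List; []; _∷_; _++_; [_]; _∷ʳ_; length)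
open import Data.List.Membership.Propositional using (_∈_)
open import Data.List.Properties using (∷ʳ-++; length-++)
open import Data.List.Relation.Binary.Permutation.Propositional using (_↭_; ↭⇒↭ₛ)
open import Data.List.Relation.Binary.Permutation.Propositional.Properties
  using (∈-resp-↭)
open import Data.List.Relation.Binary.Permutation.Setoid.Properties
  using (Unique-resp-↭)
open import Data.List.Relation.Unary.All as All using (All; []; _∷_)
open import Data.List.Relation.Unary.AllPairs using (_∷_)
open import Data.List.Relation.Unary.Any using (here; there)
open import Data.List.Relation.Unary.Unique.Propositional using (Unique)
open import Data.List.Relation.Unary.Unique.Propositional.Properties
  using (Unique[x∷xs]⇒x∉xs)
open import Data.Nat using (ℕ; zero; suc; _+_; _≤_; _<_; _⊔_; z≤n; s≤s)
open import Data.Nat.Properties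
open import Data.Nat.Tactic.RingSolver using (solve-∀)
open import Data.Product using (Σ-syntax; ∃-syntax; _×_; _,_; proj₁; proj₂)
open import Data.Sum using (inj₁; inj₂)
open import Relation.Binary.PropositionalEquality
  using (_≡_; refl; sym; trans; cong; subst; setoid)
open import Relation.Nullary using (contradiction)
open import Defs

private
  variable
    A B : Set
    K L L′ M ks ks′ N N′ σ : List A
    a b x : A
    c c′ n : ℕ

-- Transfer x L ks N c: the request x turns the list L into ks ++ x ∷ N at total
-- cost c, where ks are the items in front of x that stay there.
data Transfer {A : Set} (x : A) : List A → List A → List A → ℕ → Set where
  here : Transfer x (x ∷ N) [] N 1
  keep : Transfer x L ks N c → Transfer x (a ∷ L) (a ∷ ks) N (1 + c)
  move : Transfer x L ks N c → Transfer x (a ∷ L) ks (a ∷ N) (1 + length ks + c)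

data Transfers {A : Set} : List A → List A → ℕ → Set where
  []  : Transfers L [] 0
  _∷_ : Transfer x L ks N c → Transfers (ks ++ x ∷ N) σ c′ →
        Transfers L (x ∷ σ) (c + c′)

-- Adjacent transpositions and sequences of them.

data Swap {A : Set} : List A → List A → Set where
  here  : Swap (a ∷ b ∷ L) (b ∷ a ∷ L)
  there : Swap L M → Swap (a ∷ L) (a ∷ M)

data Swaps {A : Set} : ℕ → List A → List A → Set where
  []  : Swaps 0 L L
  _∷_ : Swap K L → Swaps n L M → Swaps (suc n) K M

swap-length : Swap L M → length L ≡ length M
swap-length here      = refl
swap-length (there s) = cong suc (swap-length s)

swap-++ʳ : Swap L M → Swap (L ++ K) (M ++ K)
swap-++ʳ here      = here
swap-++ʳ (there s) = there (swap-++ʳ s)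

swap-++ˡ : ∀ K → Swap L M → Swap (K ++ L) (K ++ M)
swap-++ˡ []      s = s
swap-++ˡ (_ ∷ K) s = there (swap-++ˡ K s)

swaps-++ˡ : ∀ K → Swaps n L M → Swaps n (K ++ L) (K ++ M)
swaps-++ˡ K []       = []
swaps-++ˡ K (s ∷ ss) = swap-++ˡ K s ∷ swaps-++ˡ K ss

swaps-∷ʳ : Swaps n K L → Swap L M → Swaps (suc n) K M
swaps-∷ʳ []       s′ = s′ ∷ []
swaps-∷ʳ (s ∷ ss) s′ = s ∷ swaps-∷ʳ ss s′

swaps-++ : ∀ {m} → Swaps m K L → Swaps n L M → Swaps (m + n) K M
swaps-++ []       ts = ts
swaps-++ (s ∷ ss) ts = s ∷ swaps-++ ss ts

swaps-shift : ∀ (a : A) K → Swaps (length K) (a ∷ K ++ L) (K ++ a ∷ L)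
swaps-shift a []      = []
swaps-shift a (k ∷ K) = here ∷ swaps-++ˡ [ k ] (swaps-shift a K)

-- The exchange argument for a single request.

-- How a transfer from a list can follow a transfer (with primed result) from
-- a list that differs by one swap.  In `passed`, the swap exchanges x with an
-- item b that the primed transfer keeps in front of x.
data Follows {A : Set} :
  List A → List A → ℕ → List A → List A → ℕ → Set where
  kept   : Swap ks ks′ → c ≤ c′ → Follows ks N c ks′ N c′
  moved  : Swap N N′ → c ≤ c′ → Follows ks N c ks N′ c′
  same   : c ≤ suc c′ → Follows ks N c ks N c′
  passed : Swaps n N (b ∷ N′) → n + c < c′ → Follows ks N c (ks ∷ʳ b) N′ c′

follows-keep : Follows ks N c ks′ N′ c′ →
               Follows (a ∷ ks) N (1 + c) (a ∷ ks′) N′ (1 + c′)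
follows-keep (kept s p)  = kept (there s) (s≤s p)
follows-keep (moved s p) = moved s (s≤s p)
follows-keep (same p)    = same (s≤s p)
follows-keep {c = c} (passed {n = n} s p) =
  passed s (s≤s (≤-trans (≤-reflexive (+-suc n c)) p))

follows-move : Follows ks N c ks′ N′ c′ →
               Follows ks (a ∷ N) (1 + length ks + c)
                       ks′ (a ∷ N′) (1 + length ks′ + c′)
follows-move (kept s p) =
  kept s (s≤s (+-mono-≤ (≤-reflexive (swap-length s)) p))
follows-move {ks = ks} (moved s p) = moved (there s) (s≤s (+-monoʳ-≤ (length ks) p))
follows-move {ks = ks} {c′ = c′} (same p) =
  same (s≤s (≤-trans (+-monoʳ-≤ (length ks) p)
                     (≤-reflexive (+-suc (length ks) c′))))
follows-move {ks = ks} {c = c} {c′ = c′} {a = a} (passed {n = n} {b = b} s p) =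
  -- The primed transfer carries `a` past `b` too; that unit pays for the extra swap from
  -- `a ∷ b ∷ N′` to `b ∷ a ∷ N′`.
  passed (swaps-∷ʳ (swaps-++ˡ [ a ] s) here) (begin
    suc (suc n + (1 + length ks + c))   ≡⟨ rearrange n (length ks) c ⟩
    1 + (length ks + 1) + suc (n + c)   ≤⟨ +-monoʳ-≤ (1 + (length ks + 1)) p ⟩
    1 + (length ks + 1) + c′            ≡⟨ cong (λ l → 1 + l + c′) (length-++ ks) ⟨
    1 + length (ks ∷ʳ b) + c′           ∎)
  where
  open ≤-Reasoning
  rearrange : ∀ n k c → suc (suc n + (1 + k + c)) ≡ 1 + (k + 1) + suc (n + c)
  rearrange = solve-∀

-- The remaining distance `n` is charged together with the cost, so that it can be paid off on later
-- requests. In `passed`, one swap beyond those within `N` brings `b` back in front of `x`.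
follows⇒swaps : Follows ks N c ks′ N′ c′ →
  ∃[ n ] (Swaps n (ks ++ x ∷ N) (ks′ ++ x ∷ N′) × n + c ≤ suc c′)
follows⇒swaps (kept s p)            = 1 , swap-++ʳ s ∷ [] , s≤s p
follows⇒swaps {ks = ks} (moved s p) = 1 , swap-++ˡ ks (there s) ∷ [] , s≤s p
follows⇒swaps (same p)              = 0 , [] , p
follows⇒swaps {ks = ks} {N′ = N′} {x = x} (passed {n = n} {b = b} s p) =
  suc n ,
  subst (Swaps _ _) (sym (∷ʳ-++ ks b (x ∷ N′)))
    (swaps-++ˡ ks (swaps-∷ʳ (swaps-++ˡ [ x ] s) here)) ,
  m≤n⇒m≤1+n p

-- Imitation: each item gets the same treatment as in the primed transfer, except that an item
-- swapped with `x` itself always ends behind `x`.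
follow : Swap L L′ → Transfer x L′ ks′ N′ c′ →
  ∃[ ks ] ∃[ N ] ∃[ c ] (Transfer x L ks N c × Follows ks N c ks′ N′ c′)
follow here here        = _ , _ , _ , move here , same ≤-refl
follow here (keep here) = _ , _ , _ , here , passed [] ≤-refl
follow here (move here) = _ , _ , _ , here , same (s≤s z≤n)
follow here (keep (keep t)) = _ , _ , _ , keep (keep t) , kept here ≤-refl
-- When one swapped item stays and the other moves, the results agree; the costs differ by the one
-- paid swap of this pair, needed only if the moved item comes first.
follow here (keep (move {ks = ks} {c = c} t)) =
  _ , _ , _ , move (keep t) , same (≤-reflexive (rearrange (length ks) c))
  where
  rearrange : ∀ k c → 2 + k + (1 + c) ≡ 1 + (1 + (1 + k + c))
  rearrange = solve-∀
follow here (move (keep {ks = ks} {c = c} t)) =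
  _ , _ , _ , keep (move t) ,
  same (≤-trans (m≤n+m _ 2) (≤-reflexive (rearrange (length ks) c)))
  where
  rearrange : ∀ k c → 2 + (1 + (1 + k + c)) ≡ 1 + (2 + k + (1 + c))
  rearrange = solve-∀
follow here (move (move t)) = _ , _ , _ , move (move t) , moved here ≤-refl
follow (there s) here = _ , _ , _ , here , moved s ≤-refl
follow (there s) (keep t) with follow s t
... | _ , _ , _ , t′ , f = _ , _ , _ , keep t′ , follows-keep f
follow (there s) (move t) with follow s t
... | _ , _ , _ , t′ , f = _ , _ , _ , move t′ , follows-move f

-- The exchange argument for request sequences.

-- Mutual induction: following the first transfer leaves `n` swaps to be handled on the shorter
-- sequence, and these are then removed one at a time, at most one unit each.
swap-transfers : ∀ σ → Swap L L′ → Transfers L′ σ c′ →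
                 ∃[ c ] (Transfers L σ c × c ≤ suc c′)
swaps-transfers : ∀ σ → Swaps n L L′ → Transfers L′ σ c′ →
                  ∃[ c ] (Transfers L σ c × c ≤ n + c′)

swap-transfers []      s []       = 0 , [] , z≤n
swap-transfers (x ∷ σ) s (_∷_ {c = c} {c′ = c′} t ts) with follow s t
... | _ , _ , d , t₁ , f with follows⇒swaps f
... | n , ss , p with swaps-transfers σ ss ts
... | d′ , ts₁ , q = d + d′ , t₁ ∷ ts₁ , (begin
  d + d′        ≤⟨ +-monoʳ-≤ d q ⟩
  d + (n + c′)  ≡⟨ rearrange d n c′ ⟩
  n + d + c′    ≤⟨ +-monoˡ-≤ c′ p ⟩
  suc c + c′    ∎)
  where
  open ≤-Reasoning
  rearrange : ∀ d n c → d + (n + c) ≡ n + d + c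
  rearrange = solve-∀

swaps-transfers σ []       ts = _ , ts , ≤-refl
swaps-transfers σ (s ∷ ss) ts with swaps-transfers σ ss ts
... | _ , ts₁ , p with swap-transfers σ s ts₁
... | c , ts₂ , q = c , ts₂ , ≤-trans q (s≤s p)

-- From schedules to subset transfers.

swap-at : ∀ xs → Swap (xs ++ a ∷ b ∷ L) (xs ++ b ∷ a ∷ L)
swap-at xs = swap-++ˡ xs here

-- All items that stay precede all that move, so no moved item crosses one that stays and only the
-- access is paid.
access-transfer : ∀ xs ys (x : A) zs →
  Transfer x (xs ++ ys ++ x ∷ zs) xs (ys ++ zs) (suc (length (xs ++ ys)))
access-transfer (_ ∷ xs) ys       x zs = keep (access-transfer xs ys x zs)
access-transfer []       (_ ∷ ys) x zs = move (access-transfer [] ys x zs)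
access-transfer []       []       x zs = here

-- Each paid exchange is dropped: by `swap-transfers`, doing without it costs at most the unit that
-- it cost.
schedule⇒transfers : Schedule L σ L′ c → ∃[ c′ ] (Transfers L σ c′ × c′ ≤ c)
schedule⇒transfers done = 0 , [] , z≤n
schedule⇒transfers (exchange xs a b ys s) with schedule⇒transfers s
... | _ , ts , p with swap-transfers _ (swap-at xs) ts
... | c , ts′ , q = c , ts′ , ≤-trans q (s≤s p)
schedule⇒transfers (access xs ys x zs s) with schedule⇒transfers s
... | _ , ts , p =
  _ , access-transfer xs ys x zs ∷ ts , +-monoʳ-≤ (suc (length (xs ++ ys))) p

-- From subset transfers to schedules.

swap-schedule : ∀ xs → Swap L M → Schedule (xs ++ M) σ L′ c →
                Schedule (xs ++ L) σ L′ (suc c)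
swap-schedule xs here s = exchange xs _ _ _ s
swap-schedule {σ = σ} {L′ = L′} xs (there {L = L} {M = M} {a = a} w) s =
  subst (λ l → Schedule l σ L′ _) (∷ʳ-++ xs a L)
    (swap-schedule (xs ∷ʳ a) w
      (subst (λ l → Schedule l σ L′ _) (sym (∷ʳ-++ xs a M)) s))

swaps-schedule : Swaps n L M → Schedule M σ L′ c → Schedule L σ L′ (n + c)
swaps-schedule []       s = s
swaps-schedule (w ∷ ws) s = swap-schedule [] w (swaps-schedule ws s)

-- Paid swaps gather the moved items `ms` directly in front of `x`, the rearmost first, so each
-- crosses only the items behind it that stay; this is the `length ks` in the cost of `move`. The
-- access then takes `x` over `ms` for free.
transfer⇒swaps : Transfer x L ks N c →
  ∃[ ms ] ∃[ zs ] ∃[ n ]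
    (N ≡ ms ++ zs × Swaps n L (ks ++ ms ++ x ∷ zs) ×
     n + suc (length (ks ++ ms)) ≡ c)
transfer⇒swaps here = [] , _ , 0 , refl , [] , refl
transfer⇒swaps (keep {a = a} t) with transfer⇒swaps t
... | ms , zs , n , refl , ss , refl =
  ms , zs , n , refl , swaps-++ˡ [ a ] ss , +-suc n _
transfer⇒swaps (move {ks = ks} {a = a} t) with transfer⇒swaps t
... | ms , zs , n , refl , ss , refl =
  a ∷ ms , zs , n + length ks , refl ,
  swaps-++ (swaps-++ˡ [ a ] ss) (swaps-shift a ks) ,
  trans (cong (λ l → n + length ks + suc l) (length-++ ks))
    (trans (rearrange n (length ks) (length ms))
      (cong (λ l → 1 + length ks + (n + suc l)) (sym (length-++ ks))))
  where
  rearrange : ∀ n k m → n + k + suc (k + suc m) ≡ 1 + k + (n + suc (k + m))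
  rearrange = solve-∀

transfer⇒schedule : Transfer x L ks N c → Schedule L [ x ] (ks ++ x ∷ N) c
transfer⇒schedule {x = x} {ks = ks} t with transfer⇒swaps t
... | ms , zs , n , refl , ss , refl =
  subst (Schedule _ _ _) (cong (n +_) (+-identityʳ _))
    (swaps-schedule ss (access ks ms x zs done))

schedule-++ : ∀ {τ} → Schedule K σ L c → Schedule L τ M c′ →
              Schedule K (σ ++ τ) M (c + c′)
schedule-++ done                   s′ = s′
schedule-++ (exchange xs a b ys s) s′ = exchange xs a b ys (schedule-++ s s′)
schedule-++ (access xs ys x zs s)  s′ =
  subst (Schedule _ _ _) (sym (+-assoc (suc (length (xs ++ ys))) _ _))
    (access xs ys x zs (schedule-++ s s′))

transfers⇒schedule : Transfers L σ c → ∃[ L′ ] Schedule L σ L′ c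
transfers⇒schedule []       = _ , done
transfers⇒schedule (t ∷ ts) =
  _ , schedule-++ (transfer⇒schedule t) (proj₂ (transfers⇒schedule ts))

transfer⇒∈ : Transfer x L ks N c → x ∈ L
transfer⇒∈ here     = here refl
transfer⇒∈ (keep t) = there (transfer⇒∈ t)
transfer⇒∈ (move t) = there (transfer⇒∈ t)

transfer⇒↭ : Transfer x L ks N c → L ↭ ks ++ x ∷ N
transfer⇒↭ t = schedule⇒↭ (transfer⇒schedule t)

-- Existence of an optimal sequence of transfers.

record SomeTransfer {A : Set} (x : A) (L : List A) : Set where
  constructor some
  field
    {stay rest} : List A
    {cost}      : ℕ
    transfer    : Transfer x L stay rest cost

  result : List A
  result = stay ++ x ∷ rest

open SomeTransfer using (cost; transfer; result)

extend : Bool → SomeTransfer x L → SomeTransfer x (a ∷ L)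
extend true  (some t) = some (keep t)
extend false (some t) = some (move t)

-- An arbitrary objective `f` lets the recursion work: fixing the fate of the first item leaves an
-- objective on transfers of the tail. `Unique` excludes transfers that stop at another occurrence
-- of `x`.
minTransfer : Unique L → x ∈ L → (f : SomeTransfer x L → ℕ) →
  Σ[ t ∈ SomeTransfer x L ] (∀ t′ → f t ≤ f t′)
minTransfer {L = L} {x = x} u (here refl) f = some here , minimal
  where
  minimal : ∀ t → f (some here) ≤ f t
  minimal (some here)     = ≤-refl
  minimal (some (keep t)) = contradiction (transfer⇒∈ t) (Unique[x∷xs]⇒x∉xs u)
  minimal (some (move t)) = contradiction (transfer⇒∈ t) (Unique[x∷xs]⇒x∉xs u)
minTransfer {L = a ∷ L} {x = x} u@(_ ∷ u′) (there x∈L) f =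
  choose (minTransfer u′ x∈L (λ t → f (extend true t)))
         (minTransfer u′ x∈L (λ t → f (extend false t)))
  where
  choose : (Σ[ t ∈ SomeTransfer x L ] (∀ t′ → f (extend true t) ≤ f (extend true t′))) →
           (Σ[ t ∈ SomeTransfer x L ] (∀ t′ → f (extend false t) ≤ f (extend false t′))) →
           Σ[ t ∈ SomeTransfer x (a ∷ L) ] (∀ t′ → f t ≤ f t′)
  choose (t₁ , min₁) (t₂ , min₂)
    with ≤-total (f (extend true t₁)) (f (extend false t₂))
  ... | inj₁ p = extend true t₁ , λ where
    (some here)     → contradiction x∈L (Unique[x∷xs]⇒x∉xs u)
    (some (keep t)) → min₁ (some t)
    (some (move t)) → ≤-trans p (min₂ (some t))
  ... | inj₂ p = extend false t₂ , λ where
    (some here)     → contradiction x∈L (Unique[x∷xs]⇒x∉xs u)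
    (some (keep t)) → ≤-trans p (min₁ (some t))
    (some (move t)) → min₂ (some t)

-- Exhaustive search: the first transfer minimises its own cost plus the optimum of the remaining
-- requests from its result, which is again duplicate-free.
minTransfers : Unique L → All (_∈ L) σ →
  ∃[ c ] (Transfers L σ c × (∀ {c′} → Transfers L σ c′ → c ≤ c′))
minTransfers {σ = []} u [] = 0 , [] , λ _ → z≤n
minTransfers {L = L} {σ = x ∷ σ} u (x∈L ∷ σ∈L) =
  total best , transfer best ∷ proj₁ (proj₂ (tail best)) , minimal
  where
  tail : (t : SomeTransfer x L) →
    ∃[ c ] (Transfers (result t) σ c × (∀ {c′} → Transfers (result t) σ c′ → c ≤ c′))
  tail (some t) = minTransfers (Unique-resp-↭ (setoid _) (↭⇒↭ₛ (transfer⇒↭ t)) u)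
                               (All.map (∈-resp-↭ (transfer⇒↭ t)) σ∈L)

  total : SomeTransfer x L → ℕ
  total t = cost t + proj₁ (tail t)

  best : SomeTransfer x L
  best = proj₁ (minTransfer u x∈L total)

  minimal : Transfers L (x ∷ σ) c′ → total best ≤ c′
  minimal (_∷_ {c = c} t ts) =
    ≤-trans (proj₂ (minTransfer u x∈L total) (some t))
            (+-monoʳ-≤ c (proj₂ (proj₂ (tail (some t))) ts))

transfers-isOPT : Transfers L σ c → (∀ {c′} → Transfers L σ c′ → c ≤ c′) →
                  IsOPT L σ c
transfers-isOPT ts minimal = transfers⇒schedule ts , bound
  where
  bound : ∀ {L′ c′} → Schedule _ _ L′ c′ → _ ≤ c′
  bound s with schedule⇒transfers s
  ... | _ , ts′ , p = ≤-trans (minimal ts′) p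

-- The advice algorithm and its tape.

-- The position recorded in `x ∈ L` fixes the number of bits, so the code needs no end marker.
readTransfer : ℕ → x ∈ L → (ℕ → SomeTransfer x L → Advised B) → Advised B
readTransfer s (here refl) k = k s (some here)
readTransfer s (there x∈L) k = read s λ b →
  readTransfer (suc s) x∈L λ s′ t → k s′ (extend b t)

-- The state is the address of the next unread bit.
transferAlgorithm : (A : Set) → OnlineAlgorithm A
transferAlgorithm A = record
  { State   = ℕ
  ; start   = λ _ → 0
  ; respond = λ s L x x∈L → readTransfer s x∈L λ s′ t →
      return (response s′ (transfer⇒schedule (transfer t)))
  }

infixr 5 _◂_
_◂_ : Bool → Tape → Tape
(b ◂ tape) zero    = b
(b ◂ tape) (suc i) = tape i

writeTransfer : Transfer x L ks N c → Tape → Tape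
writeTransfer here     tape = tape
writeTransfer (keep t) tape = true ◂ writeTransfer t tape
writeTransfer (move t) tape = false ◂ writeTransfer t tape

writeTransfers : Transfers L σ c → Tape
-- Arbitrary padding, never read.
writeTransfers []       = λ _ → false
writeTransfers (t ∷ ts) = writeTransfer t (writeTransfers ts)

-- Decoding the tape and counting the bits.

record From (tape : Tape) (s : ℕ) (suffix : Tape) : Set where
  constructor from
  field
    at : ∀ i → tape (s + i) ≡ suffix i

from-head : ∀ {b tape s suffix} → From tape s (b ◂ suffix) → tape s ≡ b
from-head {tape = tape} {s} (from at) = trans (cong tape (sym (+-identityʳ s))) (at 0)

from-tail : ∀ {b tape s suffix} → From tape s (b ◂ suffix) → From tape (suc s) suffix
from-tail {tape = tape} {s} (from at) =
  from λ i → trans (cong tape (sym (+-suc s i))) (at (suc i))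

-- The maximum with s makes the bound on the bits read compose along a run.
record Reads (tape : Tape) (s : ℕ) {x : A} {L : List A} (x∈L : x ∈ L)
             (s′ : ℕ) (t : SomeTransfer x L) : Set₁ where
  constructor reads
  field
    continue : ∀ {B : Set} (k : ℕ → SomeTransfer x L → Advised B) →
      eval tape (readTransfer s x∈L k) ≡ eval tape (k s′ t) ×
      s ⊔ prefixRead tape (readTransfer s x∈L k) ≤ s′ ⊔ prefixRead tape (k s′ t)

reads-there : ∀ {b tape s s′ t} {x∈L : x ∈ L} → tape s ≡ b →
  Reads tape (suc s) x∈L s′ t → Reads tape s (there {x = a} x∈L) s′ (extend b t)
reads-there {tape = tape} {s} {x∈L = x∈L} refl (reads continue) = reads λ k →
  let k′ = λ s′ t → k s′ (extend (tape s) t)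
      m  = prefixRead tape (readTransfer (suc s) x∈L k′)
      e , p = continue k′
  -- The bit at `s` needs a prefix of length `suc s`, which is already part of the bound for reading
  -- on from `suc s`.
  in e , ⊔-lub (≤-trans (n≤1+n s) (m⊔n≤o⇒m≤o (suc s) m p)) p

-- One bit is read per item in front of `x`, while `c` also counts the access to `x` itself, hence
-- the strict `s′ < s + c`. `Unique` makes `x∈L` and `t` agree on where `x` is.
readTransfer-written :
  ∀ {tape s suffix} → Unique L → (x∈L : x ∈ L) (t : Transfer x L ks N c) →
  From tape s (writeTransfer t suffix) →
  ∃[ s′ ] (From tape s′ suffix × s′ < s + c × Reads tape s x∈L s′ (some t))
readTransfer-written {s = s} u (here refl) here p =
  s , p , ≤-reflexive (+-comm 1 s) , reads (λ k → refl , ≤-refl)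
readTransfer-written u (here refl) (keep t) p =
  contradiction (transfer⇒∈ t) (Unique[x∷xs]⇒x∉xs u)
readTransfer-written u (here refl) (move t) p =
  contradiction (transfer⇒∈ t) (Unique[x∷xs]⇒x∉xs u)
readTransfer-written u (there x∈L) here p =
  contradiction x∈L (Unique[x∷xs]⇒x∉xs u)
readTransfer-written {s = s} (_ ∷ u) (there x∈L) (keep {c = c} t) p
  with readTransfer-written u x∈L t (from-tail p)
... | s′ , p′ , s′< , r =
  s′ , p′ , ≤-trans s′< (≤-reflexive (sym (+-suc s c))) ,
  reads-there (from-head p) r
readTransfer-written {s = s} (_ ∷ u) (there x∈L) (move {ks = ks} {c = c} t) p
  with readTransfer-written u x∈L t (from-tail p)
... | s′ , p′ , s′< , r =
  s′ , p′ ,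
  ≤-trans s′< (≤-trans (≤-reflexive (sym (+-suc s c)))
                       -- The `length ks` paid swaps need no bits and are given away.
                       (+-monoʳ-≤ s (s≤s (m≤n+m c (length ks))))) ,
  reads-there (from-head p) r

-- The strict inequality for each request saves one bit per request, which adds up to `length σ`.
run-written : ∀ {tape s} → Unique L → (σ∈L : All (_∈ L) σ) (ts : Transfers L σ c) →
  From tape s (writeTransfers ts) →
  let o = runFrom (transferAlgorithm A) tape s L σ σ∈L in
  Outcome.cost o ≡ c × s ⊔ Outcome.bitsRead o + length σ ≤ s + c
run-written {s = s} u [] [] p =
  refl , +-monoˡ-≤ 0 (≤-reflexive (⊔-identityʳ s))
run-written {L = L} {σ = x ∷ σ} {tape = tape} {s = s} u (x∈L ∷ σ∈L)
  (_∷_ {c = c} {c′ = c′} t ts) p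
  with readTransfer-written u x∈L t p
... | s′ , p′ , s′< , reads continue
  with continue (λ s′ t → return (response s′ (transfer⇒schedule (transfer t))))
-- Replaces the computed response by the one for `t`, so that the rest of the run starts at `s′`
-- from the list on which `ts` begins.
... | e , r rewrite e
  with run-written (Unique-resp-↭ (setoid _) (↭⇒↭ₛ (transfer⇒↭ t)) u)
                   (All.map (∈-resp-↭ (transfer⇒↭ t)) σ∈L) ts p′
... | cost≡ , bits≤ = cong (c +_) cost≡ , (begin
  s ⊔ (pr ⊔ br) + suc (length σ)  ≡⟨ cong (_+ suc (length σ)) (⊔-assoc s pr br) ⟨
  s ⊔ pr ⊔ br + suc (length σ)    ≤⟨ +-monoˡ-≤ _ (⊔-monoˡ-≤ br r) ⟩
  s′ ⊔ 0 ⊔ br + suc (length σ)    ≡⟨ cong (λ m → m ⊔ br + suc (length σ)) (⊔-identityʳ s′) ⟩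
  s′ ⊔ br + suc (length σ)        ≡⟨ +-suc (s′ ⊔ br) (length σ) ⟩
  suc (s′ ⊔ br + length σ)        ≤⟨ s≤s bits≤ ⟩
  suc s′ + c′                     ≤⟨ +-monoˡ-≤ c′ s′< ⟩
  s + c + c′                      ≡⟨ +-assoc s c c′ ⟩
  s + (c + c′)                    ∎)
  where
  open ≤-Reasoning
  pr = prefixRead tape (readTransfer s x∈L
         (λ s′ t → return (response s′ (transfer⇒schedule (transfer t)))))
  br = Outcome.bitsRead (runFrom (transferAlgorithm _) tape s′ _ σ
         (All.map (∈-resp-↭ (transfer⇒↭ t)) σ∈L))

theorem1 : (A : Set) →
    Σ[ alg ∈ OnlineAlgorithm A ]
    ((L₀ : List A) → Unique L₀ →
    (σ : List A) (σ∈L₀ : All (_∈ L₀) σ) →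
    Σ[ opt ∈ ℕ ] (IsOPT L₀ σ opt ×
    Σ[ tape ∈ Tape ]
    (Outcome.cost (run alg tape L₀ σ σ∈L₀) ≡ opt ×
    Outcome.bitsRead (run alg tape L₀ σ σ∈L₀) + length σ ≤ opt)))
theorem1 A = transferAlgorithm A , optimal
  where
  optimal : ∀ L₀ → Unique L₀ → ∀ σ σ∈L₀ → _
  optimal L₀ u σ σ∈L₀ with minTransfers u σ∈L₀
  ... | opt , ts , minimal =
    opt , transfers-isOPT ts minimal ,
    -- At start address 0, `s ⊔_` and `s +_` compute away in the bound.
    writeTransfers ts , run-written u σ∈L₀ ts (from λ _ → refl)
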